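{- Let $H$ be a prime graph for which there exists an $H$-induced-saturated graph $G$. Then $G \star G$ is $H$-induced-saturated, and there is a prime graph $G'$ such that $G'$ is $H$-induced-saturated.
   Context: All graphs are finite and simple. For graphs $H,G$, write $H \subseteq_I G$ if $G$ contains an induced subgraph isomorphic to $H$. A graph $G$ is $H$-induced-saturated if $H \not\subseteq_I G$, but $H \subseteq_I G - e$ for every edge $e \in E(G)$ and $H \subseteq_I G + e$ for every edge $e \in E(\overline{G})$ of the complement. A homogeneous set of an $n$-vertex graph $G$ is a set $X \subsetneq V(G)$ with $2 \leq |X| \leq n-1$ such that every vertex $v \in V(G)\setminus X$ satisfies $X \subseteq N(v)$ or $X \cap N(v)=\emptyset$. A graph is prime if it has no homogeneous set. For graphs $G_1=(V_1,E_1)$ and $G_2=(V_2,E_2)$, the blowup product $G_1 \star G_2$ is the graph on vertex set $V_1\times V_2$ in which $(u_1,v_1)$ and $(u_2,v_2)$ are adjacent iff either $u_1u_2 \in E_1$, or $u_1=u_2$ and $v_1v_2 \in E_2$. -}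

module Defs where

open import Data.Fin using (Fin; zero; suc)
import Data.Fin.Properties as Fin
open import Data.Fin.Subset using (Subset; inside; outside; _∈_; _⊆_; _∩_; Empty; ∣_∣)
open import Data.Nat using (ℕ; _*_; _≤_; _<_)
open import Data.Product using (Σ; ∃; ∃-syntax; _×_; _,_; proj₁; proj₂)
open import Data.Product.Function.NonDependent.Propositional using (_×-↔_)
open import Data.Sum using (_⊎_; inj₁; inj₂)
open import Data.Vec using (_∷_; here; there; tabulate)
open import Data.Vec.Properties.WithK using ([]=-irrelevant)
open import Function.Bundles using (_↔_; _⇔_; Inverse; mk↔ₛ′)
open import Function.Properties.Inverse using (↔-sym; ↔-trans; ↔⇒↣)
open import Level using (0ℓ)
open import Relation.Binary.Core using (Rel)
open import Relation.Binary.Definitions using (Decidable; DecidableEquality; Symmetric)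
open import Relation.Binary.PropositionalEquality using (_≡_; _≢_; refl; sym; trans; cong; subst)
open import Relation.Nullary using (¬_; Dec; does)
open import Relation.Nullary.Decidable using (¬?; _×-dec_; _⊎-dec_; via-injection)

record Graph : Set₁ where
  field
    Vertex   : Set
    order    : ℕ
    vertices : Vertex ↔ Fin order
    Adj      : Rel Vertex 0ℓ
    adj?     : Decidable Adj
    Adj-sym  : Symmetric Adj
    loopless : ∀ {v} → ¬ Adj v v

  open Inverse vertices public using ()
    renaming (to to index; from to vertex; strictlyInverseˡ to index-vertex; strictlyInverseʳ to vertex-index)

  _≟_ : DecidableEquality Vertex
  _≟_ = via-injection (↔⇒↣ vertices) Fin._≟_

  -- Sets of vertices are subsets of Fin order, transported along the enumeration.
  VertexSet : Set
  VertexSet = Subset order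

  infix 4 _∈ᵥ_
  _∈ᵥ_ : Vertex → VertexSet → Set
  v ∈ᵥ X = index v ∈ X

  N : Vertex → VertexSet
  N v = tabulate λ i → does (adj? v (vertex i))

open Graph public using (Vertex; order; Adj; VertexSet)

-- Equality of the unordered pairs {x , y} and {u , v}.
SamePair : {V : Set} → V → V → V → V → Set
SamePair x y u v = (x ≡ u × y ≡ v) ⊎ (x ≡ v × y ≡ u)

module _ {V : Set} where

  samePair-flip : {x y u v : V} → SamePair x y u v → SamePair y x u v
  samePair-flip (inj₁ (p , q)) = inj₂ (q , p)
  samePair-flip (inj₂ (p , q)) = inj₁ (q , p)

  samePair-diag : {x u v : V} → SamePair x x u v → u ≡ v
  samePair-diag (inj₁ (p , q)) = trans (sym p) q
  samePair-diag (inj₂ (p , q)) = trans (sym q) p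

  samePair? : DecidableEquality V → (x y u v : V) → Dec (SamePair x y u v)
  samePair? _≟_ x y u v = (x ≟ u ×-dec y ≟ v) ⊎-dec (x ≟ v ×-dec y ≟ u)

complement : Graph → Graph
complement G = record
  { Vertex   = G.Vertex
  ; order    = G.order
  ; vertices = G.vertices
  ; Adj      = λ x y → x ≢ y × ¬ G.Adj x y
  ; adj?     = λ x y → ¬? (x G.≟ y) ×-dec ¬? (G.adj? x y)
  ; Adj-sym  = λ (x≢y , ¬xy) → (λ y≡x → x≢y (sym y≡x)) , (λ yx → ¬xy (G.Adj-sym yx))
  ; loopless = λ (v≢v , _) → v≢v refl
  }
  where module G = Graph G

deleteEdge : (G : Graph) {u v : Vertex G} → Adj G u v → Graph
deleteEdge G {u} {v} _ = record
  { Vertex   = G.Vertex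
  ; order    = G.order
  ; vertices = G.vertices
  ; Adj      = λ x y → G.Adj x y × ¬ SamePair x y u v
  ; adj?     = λ x y → G.adj? x y ×-dec ¬? (samePair? G._≟_ x y u v)
  ; Adj-sym  = λ (xy , ≢uv) → G.Adj-sym xy , λ ≡uv → ≢uv (samePair-flip ≡uv)
  ; loopless = λ (vv , _) → G.loopless vv
  }
  where module G = Graph G

addEdge : (G : Graph) {u v : Vertex G} → Adj (complement G) u v → Graph
addEdge G {u} {v} (u≢v , _) = record
  { Vertex   = G.Vertex
  ; order    = G.order
  ; vertices = G.vertices
  ; Adj      = λ x y → G.Adj x y ⊎ SamePair x y u v
  ; adj?     = λ x y → G.adj? x y ⊎-dec samePair? G._≟_ x y u v
  ; Adj-sym  = λ { (inj₁ xy)  → inj₁ (G.Adj-sym xy)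
                 ; (inj₂ ≡uv) → inj₂ (samePair-flip ≡uv) }
  ; loopless = λ { (inj₁ vv)  → G.loopless vv
                 ; (inj₂ ≡uv) → u≢v (samePair-diag ≡uv) }
  }
  where module G = Graph G

rank : ∀ {n} (S : Subset n) → ∃ (_∈ S) → Fin ∣ S ∣
rank (inside  ∷ S) (zero  , here)    = zero
rank (inside  ∷ S) (suc i , there p) = suc (rank S (i , p))
rank (outside ∷ S) (suc i , there p) = rank S (i , p)

shift : ∀ {n b} {S : Subset n} → ∃ (_∈ S) → ∃ (_∈ (b ∷ S))
shift (i , p) = suc i , there p

unrank : ∀ {n} (S : Subset n) → Fin ∣ S ∣ → ∃ (_∈ S)
unrank (inside  ∷ S) zero    = zero , here
unrank (inside  ∷ S) (suc k) = shift (unrank S k)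
unrank (outside ∷ S) k       = shift (unrank S k)

rank-unrank : ∀ {n} (S : Subset n) k → rank S (unrank S k) ≡ k
rank-unrank (inside  ∷ S) zero    = refl
rank-unrank (inside  ∷ S) (suc k) = cong suc (rank-unrank S k)
rank-unrank (outside ∷ S) k       = rank-unrank S k

unrank-rank : ∀ {n} (S : Subset n) x → unrank S (rank S x) ≡ x
unrank-rank (inside  ∷ S) (zero  , here)    = refl
unrank-rank (inside  ∷ S) (suc i , there p) = cong shift (unrank-rank S (i , p))
unrank-rank (outside ∷ S) (suc i , there p) = cong shift (unrank-rank S (i , p))

∃∈↔Fin : ∀ {n} (S : Subset n) → ∃ (_∈ S) ↔ Fin ∣ S ∣
∃∈↔Fin S = mk↔ₛ′ (rank S) (unrank S) (rank-unrank S) (unrank-rank S)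

module _ (G : Graph) where
  private module G = Graph G

  ∈ᵥ-enumeration : (S : VertexSet G) → ∃ (G._∈ᵥ S) ↔ ∃ (_∈ S)
  ∈ᵥ-enumeration S = mk↔ₛ′
    (λ (v , p) → G.index v , p)
    (λ (i , p) → G.vertex i , subst (_∈ S) (sym (G.index-vertex i)) p)
    (λ (i , p) → pair-≡ (G.index-vertex i))
    (λ (v , p) → pair-≡ᵥ (G.vertex-index v))
    where
    pair-≡ : ∀ {i j} {p : i ∈ S} {q : j ∈ S} → i ≡ j → (i , p) ≡ (j , q)
    pair-≡ {p = p} {q} refl = cong (_ ,_) ([]=-irrelevant p q)

    pair-≡ᵥ : ∀ {u v} {p : u G.∈ᵥ S} {q : v G.∈ᵥ S} → u ≡ v → _≡_ {A = ∃ (G._∈ᵥ S)} (u , p) (v , q)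
    pair-≡ᵥ {p = p} {q} refl = cong (_ ,_) ([]=-irrelevant p q)

  induced : VertexSet G → Graph
  induced S = record
    { Vertex   = ∃ (G._∈ᵥ S)
    ; order    = ∣ S ∣
    ; vertices = ↔-trans (∈ᵥ-enumeration S) (∃∈↔Fin S)
    ; Adj      = λ (x , _) (y , _) → G.Adj x y
    ; adj?     = λ (x , _) (y , _) → G.adj? x y
    ; Adj-sym  = G.Adj-sym
    ; loopless = G.loopless
    }

infix 4 _≅_ _⊆ᴵ_

_≅_ : Graph → Graph → Set
H ≅ G = Σ (Vertex H ↔ Vertex G) λ φ →
  ∀ u v → Adj H u v ⇔ Adj G (Inverse.to φ u) (Inverse.to φ v)

_⊆ᴵ_ : Graph → Graph → Set
H ⊆ᴵ G = ∃[ S ] H ≅ induced G S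

record InducedSaturated (H G : Graph) : Set where
  field
    H-free   : ¬ H ⊆ᴵ G
    deletion : ∀ {u v} (e : Adj G u v) → H ⊆ᴵ deleteEdge G e
    addition : ∀ {u v} (e : Adj (complement G) u v) → H ⊆ᴵ addEdge G e

record Homogeneous (G : Graph) (X : VertexSet G) : Set where
  open Graph G using (_∈ᵥ_; N)
  field
    at-least-two : 2 ≤ ∣ X ∣
    proper       : ∣ X ∣ < order G
    uniform      : ∀ v → ¬ v ∈ᵥ X → X ⊆ N v ⊎ Empty (X ∩ N v)

Prime : Graph → Set
Prime G = ¬ ∃ (Homogeneous G)

infixl 7 _⋆_

_⋆_ : Graph → Graph → Graph
G₁ ⋆ G₂ = record
  { Vertex   = G₁.Vertex × G₂.Vertex
  ; order    = G₁.order * G₂.order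
  ; vertices = ↔-trans (G₁.vertices ×-↔ G₂.vertices) (↔-sym Fin.*↔×)
  ; Adj      = λ (u₁ , v₁) (u₂ , v₂) → G₁.Adj u₁ u₂ ⊎ (u₁ ≡ u₂ × G₂.Adj v₁ v₂)
  ; adj?     = λ (u₁ , v₁) (u₂ , v₂) → G₁.adj? u₁ u₂ ⊎-dec (u₁ G₁.≟ u₂ ×-dec G₂.adj? v₁ v₂)
  ; Adj-sym  = λ { (inj₁ u₁u₂)          → inj₁ (G₁.Adj-sym u₁u₂)
                 ; (inj₂ (u₁≡u₂ , v₁v₂)) → inj₂ (sym u₁≡u₂ , G₂.Adj-sym v₁v₂) }
  ; loopless = λ { (inj₁ uu)       → G₁.loopless uu
                 ; (inj₂ (_ , vv)) → G₂.loopless vv }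
  }
  where
  module G₁ = Graph G₁
  module G₂ = Graph G₂

{-# OPTIONS --safe #-}
-- A vertex set is a module when each vertex outside it sees all or none of it.
-- The trace of a module on an induced copy of a prime graph H has at most one
-- vertex or is the whole copy.
--
-- The fibres of the first projection are modules of G ⋆ G, so an induced copy of
-- H in G ⋆ G either projects injectively to the first factor or lies in one copy
-- of the second; either way H would be induced in G.  Flipping a pair of G ⋆ G
-- flips a pair in a transversal copy of G or in a fibre.
--
-- If G itself is not prime, let X be a homogeneous set.  Flipping a pair inside X
-- leaves X a module, and the copy of H that appears contains both ends of the
-- pair, hence lies in X.  So the subgraph induced by X is again H-induced-saturated,
-- and iterating this ends in a prime graph.
module Submission where

open import Defs
open import Data.Product using (_×_; ∃-syntax)

open import Data.Bool using (true)
open import Data.Empty using (⊥-elim)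
import Data.Fin.Properties as Fin
open import Data.Fin.Subset using (Subset; _∈_; _⊆_; _∩_; ∣_∣; Empty)
open import Data.Fin.Subset.Properties as Subset
  using (_∈?_; _⊆?_; nonempty?; anySubset?; ∣⊤∣≡n; p⊂q⇒∣p∣<∣q∣; x∈p∩q⁺; x∈p∩q⁻;
         x∈p∧x≢y⇒x∈p-y; x∈p⇒∣p-x∣<∣p∣)
open import Data.Nat using (_≤_; _<_; z≤n; s≤s)
open import Data.Nat.Induction using (<-wellFounded)
import Data.Nat.Properties as ℕ
open import Data.Product using (∃; _,_; proj₁; proj₂)
open import Data.Sum using (_⊎_; inj₁; inj₂)
import Data.Sum as Sum
open import Data.Vec using (tabulate)
open import Data.Vec.Properties using (lookup∘tabulate; []=⇒lookup; lookup⇒[]=)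
open import Data.Vec.Properties.WithK using ([]=-irrelevant)
open import Function.Base using (_∘_; id)
open import Function.Bundles using (_⇔_; Inverse; Equivalence; mk⇔; mk⤖)
open import Function.Definitions using (Injective)
open import Function.Properties.Bijection using (⤖⇒↔)
open import Induction.WellFounded using (Acc; acc)
open import Level using (0ℓ)
open import Relation.Binary.Core using (Rel)
open import Relation.Binary.PropositionalEquality
  using (_≡_; _≢_; refl; sym; trans; cong; subst)
open import Relation.Nullary using (¬_; Dec; yes; no; does)
open import Relation.Nullary.Decidable
  using (map′; ¬?; _×-dec_; _⊎-dec_; _→-dec_; dec-true; decidable-stable)
open import Relation.Unary using (Decidable)

open Equivalence using (to; from)

-- Cardinality bounds for finite subsets.

does⇒ : {A : Set} (a? : Dec A) → does a? ≡ true → A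
does⇒ (yes a) _ = a

nonempty⇒0<∣p∣ : ∀ {n x} {p : Subset n} → x ∈ p → 0 < ∣ p ∣
nonempty⇒0<∣p∣ x∈p = ℕ.≤-trans (s≤s z≤n) (x∈p⇒∣p-x∣<∣p∣ x∈p)

distinct⇒2≤∣p∣ : ∀ {n x y} {p : Subset n} → x ∈ p → y ∈ p → x ≢ y → 2 ≤ ∣ p ∣
distinct⇒2≤∣p∣ x∈p y∈p x≢y =
  ℕ.≤-trans (s≤s (nonempty⇒0<∣p∣ (x∈p∧x≢y⇒x∈p-y x∈p x≢y))) (x∈p⇒∣p-x∣<∣p∣ y∈p)

missing⇒∣p∣<n : ∀ {n x} {p : Subset n} → ¬ x ∈ p → ∣ p ∣ < n
missing⇒∣p∣<n {n} {x} {p} x∉p =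
  subst (∣ p ∣ <_) (∣⊤∣≡n n) (p⊂q⇒∣p∣<∣q∣ ((λ _ → Subset.∈⊤) , x , Subset.∈⊤ , x∉p))

-- Decidable vertex predicates, homogeneous sets and modules.

module _ (G : Graph) where
  open Graph G using (index; vertex; vertex-index; index-vertex; adj?; _∈ᵥ_; N)

  index-injective : ∀ {u v} → index u ≡ index v → u ≡ v
  index-injective {u} {v} eq =
    trans (sym (vertex-index u)) (trans (cong vertex eq) (vertex-index v))

  any-vertex? : {P : Vertex G → Set} → Decidable P → Dec (∃ P)
  any-vertex? {P} P? = map′
    (λ (i , p) → vertex i , p)
    (λ (v , p) → index v , subst P (sym (vertex-index v)) p)
    (Fin.any? (P? ∘ vertex))

  all-vertices? : {P : Vertex G → Set} → Decidable P → Dec (∀ v → P v)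
  all-vertices? {P} P? = map′
    (λ p v → subst P (vertex-index v) (p (index v)))
    (λ p i → p (vertex i))
    (Fin.all? (P? ∘ vertex))

  setOf : {P : Vertex G → Set} → Decidable P → VertexSet G
  setOf P? = tabulate (does ∘ P? ∘ vertex)

  ∈-setOf : {P : Vertex G → Set} (P? : Decidable P) → ∀ {v} → v ∈ᵥ setOf P? ⇔ P v
  ∈-setOf {P} P? {v} = mk⇔
    (λ p → subst P (vertex-index v)
      (does⇒ (P? _) (trans (sym (lookup∘tabulate _ (index v))) ([]=⇒lookup p))))
    (λ p → lookup⇒[]= (index v) _ (trans (lookup∘tabulate _ (index v))
      (dec-true (P? _) (subst P (sym (vertex-index v)) p))))

  ∈ᵥ-pair-≡ : {S : VertexSet G} {x y : ∃ (_∈ᵥ S)} → proj₁ x ≡ proj₁ y → x ≡ y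
  ∈ᵥ-pair-≡ {x = _ , p} {_ , q} refl = cong (_ ,_) ([]=-irrelevant p q)

  -- Allows an exhaustive search for a homogeneous set, so that the descent to a prime graph is
  -- constructive.
  homogeneous? : (X : VertexSet G) → Dec (Homogeneous G X)
  homogeneous? X = map′
    (λ (p , q , r) → record { at-least-two = p ; proper = q ; uniform = r })
    (λ h → let open Homogeneous h in at-least-two , proper , uniform)
    (2 ℕ.≤? ∣ X ∣ ×-dec ∣ X ∣ ℕ.<? order G ×-dec
     all-vertices? (λ v → ¬? (index v ∈? X) →-dec
                          (X ⊆? N v ⊎-dec ¬? (nonempty? (X ∩ N v)))))

  homogeneous-adj : ∀ {X} → Homogeneous G X → ∀ {v x y} →
    ¬ v ∈ᵥ X → x ∈ᵥ X → y ∈ᵥ X → Adj G v x → Adj G v y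
  homogeneous-adj h {v} v∉X x∈X y∈X vx with Homogeneous.uniform h v v∉X
  ... | inj₁ X⊆N = to (∈-setOf (adj? v)) (X⊆N y∈X)
  ... | inj₂ X∩N=∅ = ⊥-elim (X∩N=∅ (_ , x∈p∩q⁺ (x∈X , from (∈-setOf (adj? v)) vx)))

  -- If some `v` were outside `P`, then `a`, `b` and `v` would give the size bounds that make the
  -- module a homogeneous set. A one-way implication expresses uniformity because `x` and `y` can be
  -- exchanged.
  prime-module : Prime G → {P : Vertex G → Set} → Decidable P →
    (∀ {v x y} → ¬ P v → P x → P y → Adj G v x → Adj G v y) →
    ∀ {a b} → P a → P b → a ≢ b → ∀ v → P v
  prime-module prime {P} P? P-module {a} {b} pa pb a≢b v =
    decidable-stable (P? v) λ ¬pv → prime (X , record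
      { at-least-two = distinct⇒2≤∣p∣ (∈X pa) (∈X pb) (a≢b ∘ index-injective)
      ; proper       = missing⇒∣p∣<n (¬pv ∘ X∈)
      ; uniform      = uniform
      })
    where
    X = setOf P?

    ∈X : ∀ {u} → P u → u ∈ᵥ X
    ∈X = from (∈-setOf P?)

    X∈ : ∀ {u} → u ∈ᵥ X → P u
    X∈ = to (∈-setOf P?)

    ∈X⇒P : ∀ {i} → i ∈ X → P (vertex i)
    ∈X⇒P {i} i∈X = X∈ (subst (_∈ X) (sym (index-vertex i)) i∈X)

    ∈N⇒Adj : ∀ {u i} → i ∈ N u → Adj G u (vertex i)
    ∈N⇒Adj {u} {i} i∈N =
      to (∈-setOf (adj? u)) (subst (_∈ N u) (sym (index-vertex i)) i∈N)

    uniform : ∀ u → ¬ u ∈ᵥ X → X ⊆ N u ⊎ Empty (X ∩ N u)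
    -- Adjacency to the single member `a` decides between all and none.
    uniform u u∉X with adj? u a
    ... | yes ua = inj₁ λ {i} i∈X → subst (_∈ N u) (index-vertex i)
      (from (∈-setOf (adj? u)) (P-module (u∉X ∘ ∈X) pa (∈X⇒P i∈X) ua))
    ... | no ¬ua = inj₂ λ (i , i∈X∩N) → let (i∈X , i∈N) = x∈p∩q⁻ X (N u) i∈X∩N in
      ¬ua (P-module (u∉X ∘ ∈X) (∈X⇒P i∈X) pa (∈N⇒Adj i∈N))

-- Induced copies as embeddings.

infix 4 _↪_

-- The target is a bare relation, so that a graph and its one-pair modifications
-- visibly share their vertex type.
record _↪_ (H : Graph) {V : Set} (R : Rel V 0ℓ) : Set where
  field
    fun       : Vertex H → V
    injective : Injective _≡_ _≡_ fun
    adj       : ∀ {x y} → Adj H x y ⇔ R (fun x) (fun y)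

open _↪_

module _ {V : Set} {R : Rel V 0ℓ} {H K : Graph} where

  ↪-trans : H ↪ Adj K → K ↪ R → H ↪ R
  ↪-trans f g = record
    { fun       = fun g ∘ fun f
    ; injective = injective f ∘ injective g
    ; adj       = mk⇔ (to (adj g) ∘ to (adj f)) (from (adj f) ∘ from (adj g))
    }

  -- Pulls a copy of `H` back to `K` once its image is known to lie in that of `g`; the lift `k`
  -- inherits injectivity and adjacency from `f`.
  ↪-factor : (f : H ↪ R) (g : K ↪ R) (k : Vertex H → Vertex K) →
    (∀ x → fun g (k x) ≡ fun f x) → H ↪ Adj K
  ↪-factor f g k gk≡f = record
    { fun       = k
    ; injective = λ {x} {y} eq →
        injective f (trans (sym (gk≡f x)) (trans (cong (fun g) eq) (gk≡f y)))
    ; adj       = λ {x} {y} → mk⇔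
        (λ xy → from (adj g) (transport (sym (gk≡f x)) (sym (gk≡f y)) (to (adj f) xy)))
        (λ xy → from (adj f) (transport (gk≡f x) (gk≡f y) (to (adj g) xy)))
    }
    where
    transport : ∀ {x x′ y y′} → x ≡ x′ → y ≡ y′ → R x y → R x′ y′
    transport refl refl r = r

module _ {H : Graph} (G : Graph) where

  ⊆ᴵ⇒↪ : H ⊆ᴵ G → H ↪ Adj G
  ⊆ᴵ⇒↪ (S , φ , φ-adj) = record
    { fun       = proj₁ ∘ Inverse.to φ
    ; injective = λ {x} {y} eq → trans (sym (Inverse.strictlyInverseʳ φ x))
        (trans (cong (Inverse.from φ) (∈ᵥ-pair-≡ G eq)) (Inverse.strictlyInverseʳ φ y))
    ; adj       = φ-adj _ _
    }

  -- Finite search makes the image of `f` decidable, hence a vertex set, and `f` is a bijection onto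
  -- it.
  ↪⇒⊆ᴵ : H ↪ Adj G → H ⊆ᴵ G
  ↪⇒⊆ᴵ f = setOf G hit? , ⤖⇒↔ (mk⤖ (φ-injective , φ-surjective)) , λ _ _ → adj f
    where
    hit? : Decidable λ v → ∃ λ x → fun f x ≡ v
    hit? v = any-vertex? H λ x → Graph._≟_ G (fun f x) v

    φ : Vertex H → Vertex (induced G (setOf G hit?))
    φ x = fun f x , from (∈-setOf G hit?) (x , refl)

    φ-injective : Injective _≡_ _≡_ φ
    φ-injective = injective f ∘ cong proj₁

    φ-surjective : ∀ y → ∃ λ x → ∀ {z} → z ≡ x → φ z ≡ y
    φ-surjective (v , v∈S) = let (x , fx≡v) = to (∈-setOf G hit?) v∈S in
      x , λ { refl → ∈ᵥ-pair-≡ G fx≡v }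

induced-↪ : (G : Graph) (S : VertexSet G) → induced G S ↪ Adj G
induced-↪ G S = record
  { fun       = proj₁
  ; injective = ∈ᵥ-pair-≡ G
  ; adj       = mk⇔ id id
  }

-- Flipping a pair commutes with embeddings.

module _ {V W : Set} {f : V → W} where

  samePair-map : ∀ {x y u v} → SamePair x y u v → SamePair (f x) (f y) (f u) (f v)
  samePair-map = Sum.map (λ (p , q) → cong f p , cong f q) (λ (p , q) → cong f p , cong f q)

  samePair-unmap : Injective _≡_ _≡_ f →
    ∀ {x y u v} → SamePair (f x) (f y) (f u) (f v) → SamePair x y u v
  samePair-unmap inj = Sum.map (λ (p , q) → inj p , inj q) (λ (p , q) → inj p , inj q)

module _ (K G : Graph) (f : K ↪ Adj G) where

  -- By injectivity of `f`, a pair of `K` is the deleted one exactly when its image is. The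
  -- endpoints in `G` are given by equations because a section through two points meets them only
  -- propositionally.
  deleteEdge-↪ : ∀ {u v u′ v′} (e : Adj K u v) (e′ : Adj G u′ v′) →
    fun f u ≡ u′ → fun f v ≡ v′ → deleteEdge K e ↪ Adj (deleteEdge G e′)
  deleteEdge-↪ e e′ refl refl = record
    { fun       = fun f
    ; injective = injective f
    ; adj       = mk⇔
        (λ (xy , ≢uv) → to (adj f) xy , ≢uv ∘ samePair-unmap (injective f))
        (λ (xy , ≢uv) → from (adj f) xy , ≢uv ∘ samePair-map)
    }

  addEdge-↪ : ∀ {u v u′ v′} (e : Adj (complement K) u v) (e′ : Adj (complement G) u′ v′) →
    fun f u ≡ u′ → fun f v ≡ v′ → addEdge K e ↪ Adj (addEdge G e′)
  addEdge-↪ e e′ refl refl = record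
    { fun       = fun f
    ; injective = injective f
    ; adj       = mk⇔
        (Sum.map (to (adj f)) samePair-map)
        (Sum.map (from (adj f)) (samePair-unmap (injective f)))
    }

-- Blowup products.

module _ (G₁ G₂ : Graph) where
  private
    module G₁ = Graph G₁
    module G₂ = Graph G₂

  -- A transversal meets each fibre once, so the second kind of adjacency would need a loop in `G₂`.
  ⋆-section : (Vertex G₁ → Vertex G₂) → G₁ ↪ Adj (G₁ ⋆ G₂)
  ⋆-section s = record
    { fun       = λ x → x , s x
    ; injective = cong proj₁
    ; adj       = mk⇔ inj₁ λ { (inj₁ xy) → xy ; (inj₂ (refl , xx)) → ⊥-elim (G₂.loopless xx) }
    }

  ⋆-fibre : Vertex G₁ → G₂ ↪ Adj (G₁ ⋆ G₂)
  ⋆-fibre u = record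
    { fun       = u ,_
    ; injective = cong proj₂
    ; adj       = mk⇔ (inj₂ ∘ (refl ,_))
        λ { (inj₁ uu) → ⊥-elim (G₁.loopless uu) ; (inj₂ (_ , xy)) → xy }
    }

  ⋆-section-through : ∀ {u₁ u₂} → u₁ ≢ u₂ → (v₁ v₂ : Vertex G₂) →
    ∃ λ (f : G₁ ↪ Adj (G₁ ⋆ G₂)) → fun f u₁ ≡ (u₁ , v₁) × fun f u₂ ≡ (u₂ , v₂)
  ⋆-section-through {u₁} {u₂} u₁≢u₂ v₁ v₂ =
    ⋆-section s , cong (u₁ ,_) s₁ , cong (u₂ ,_) s₂
    where
    s : Vertex G₁ → Vertex G₂
    s x with x G₁.≟ u₁
    ... | yes _ = v₁
    -- The default value `v₂` serves `u₂`; elsewhere the choice is arbitrary.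
    ... | no  _ = v₂

    s₁ : s u₁ ≡ v₁
    s₁ with u₁ G₁.≟ u₁
    ... | yes _  = refl
    ... | no u≢u = ⊥-elim (u≢u refl)

    s₂ : s u₂ ≡ v₂
    s₂ with u₂ G₁.≟ u₁
    ... | yes u₂≡u₁ = ⊥-elim (u₁≢u₂ (sym u₂≡u₁))
    ... | no _      = refl

  ⋆-free : {H : Graph} → Prime H → ¬ H ↪ Adj G₁ → ¬ H ↪ Adj G₂ → ¬ H ↪ Adj (G₁ ⋆ G₂)
  ⋆-free {H} prime H↪̸G₁ H↪̸G₂ f = H↪̸G₁ record
    { fun       = π₁
    ; injective = π₁-injective
    ; adj       = mk⇔
        (λ xy → π₁-adj (to (adj f) xy) λ { refl → Graph.loopless H xy })
        (from (adj f) ∘ inj₁)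
    }
    where
    π₁ : Vertex H → Vertex G₁
    π₁ = proj₁ ∘ fun f

    π₁-injective : Injective _≡_ _≡_ π₁
    π₁-injective {a} {b} πa≡πb = decidable-stable (Graph._≟_ H a b) λ a≢b →
      -- Two vertices with the same projection force all of `H` into one fibre, which is a copy of
      -- `G₂`.
      let one-fibre = prime-module H prime (λ x → π₁ x G₁.≟ π₁ b)
            fibre-module πa≡πb refl a≢b
      in H↪̸G₂ (↪-factor f (⋆-fibre (π₁ b)) (proj₂ ∘ fun f)
           λ x → cong (_, proj₂ (fun f x)) (sym (one-fibre x)))
      where
      -- Between different fibres adjacency depends on first coordinates only.
      fibre-module : ∀ {v x y} → π₁ v ≢ π₁ b → π₁ x ≡ π₁ b → π₁ y ≡ π₁ b →
        Adj H v x → Adj H v y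
      fibre-module {v} v∉ x∈ y∈ vx with to (adj f) vx
      ... | inj₁ πvπx = from (adj f) (inj₁ (subst (Adj G₁ (π₁ v)) (trans x∈ (sym y∈)) πvπx))
      ... | inj₂ (πv≡πx , _) = ⊥-elim (v∉ (trans πv≡πx x∈))

    π₁-adj : ∀ {x y} → Adj (G₁ ⋆ G₂) (fun f x) (fun f y) → x ≢ y → Adj G₁ (π₁ x) (π₁ y)
    π₁-adj (inj₁ πxπy)        _   = πxπy
    π₁-adj (inj₂ (πx≡πy , _)) x≢y = ⊥-elim (x≢y (π₁-injective πx≡πy))

⋆-saturated : {H : Graph} → Prime H → (G₁ G₂ : Graph) →
  InducedSaturated H G₁ → InducedSaturated H G₂ → InducedSaturated H (G₁ ⋆ G₂)
⋆-saturated {H} prime G₁ G₂ sat₁ sat₂ = record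
  { H-free   = λ H⊆ → ⋆-free G₁ G₂ prime (S₁.H-free ∘ ↪⇒⊆ᴵ G₁) (S₂.H-free ∘ ↪⇒⊆ᴵ G₂)
                        (⊆ᴵ⇒↪ (G₁ ⋆ G₂) H⊆)
  ; deletion = deletion
  ; addition = addition
  }
  where
  module S₁ = InducedSaturated sat₁
  module S₂ = InducedSaturated sat₂

  deletion-via : ∀ {K u v x y} (f : K ↪ Adj (G₁ ⋆ G₂)) (e : Adj K u v) (e′ : Adj (G₁ ⋆ G₂) x y) →
    fun f u ≡ x → fun f v ≡ y → H ⊆ᴵ deleteEdge K e → H ⊆ᴵ deleteEdge (G₁ ⋆ G₂) e′
  deletion-via {K} f e e′ p q H⊆ = ↪⇒⊆ᴵ {H} (deleteEdge (G₁ ⋆ G₂) e′)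
    (↪-trans (⊆ᴵ⇒↪ (deleteEdge K e) H⊆) (deleteEdge-↪ K (G₁ ⋆ G₂) f e e′ p q))

  addition-via : ∀ {K u v x y} (f : K ↪ Adj (G₁ ⋆ G₂))
    (e : Adj (complement K) u v) (e′ : Adj (complement (G₁ ⋆ G₂)) x y) →
    fun f u ≡ x → fun f v ≡ y → H ⊆ᴵ addEdge K e → H ⊆ᴵ addEdge (G₁ ⋆ G₂) e′
  addition-via {K} f e e′ p q H⊆ = ↪⇒⊆ᴵ {H} (addEdge (G₁ ⋆ G₂) e′)
    (↪-trans (⊆ᴵ⇒↪ (addEdge K e) H⊆) (addEdge-↪ K (G₁ ⋆ G₂) f e e′ p q))

  deletion : ∀ {x y} (e : Adj (G₁ ⋆ G₂) x y) → H ⊆ᴵ deleteEdge (G₁ ⋆ G₂) e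
  -- A pair across two fibres lies in a transversal copy of `G₁`; a pair within a fibre lies in a
  -- copy of `G₂`.
  deletion {_ , v₁} {_ , v₂} e@(inj₁ uu) =
    let (f , p , q) = ⋆-section-through G₁ G₂ (λ { refl → Graph.loopless G₁ uu }) v₁ v₂
    in deletion-via f uu e p q (S₁.deletion uu)
  deletion {u , _} e@(inj₂ (refl , vv)) =
    deletion-via (⋆-fibre G₁ G₂ u) vv e refl refl (S₂.deletion vv)

  addition : ∀ {x y} (e : Adj (complement (G₁ ⋆ G₂)) x y) → H ⊆ᴵ addEdge (G₁ ⋆ G₂) e
  addition {u₁ , v₁} {u₂ , v₂} e@(x≢y , ¬xy) with Graph._≟_ G₁ u₁ u₂
  ... | yes refl =
    let vv = x≢y ∘ cong (u₁ ,_) , ¬xy ∘ inj₂ ∘ (refl ,_)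
    in addition-via (⋆-fibre G₁ G₂ u₁) vv e refl refl (S₂.addition vv)
  ... | no u₁≢u₂ =
    let uu          = u₁≢u₂ , ¬xy ∘ inj₁
        (f , p , q) = ⋆-section-through G₁ G₂ u₁≢u₂ v₁ v₂
    in addition-via f uu e p q (S₁.addition uu)

-- Copies of `H` created by changing one pair.

module _ {H : Graph} (prime : Prime H) (G : Graph) (H↪̸G : ¬ H ↪ Adj G)
         {R : Rel (Vertex G) 0ℓ} {u v : Vertex G} (u≢v : u ≢ v)
         (agree : ∀ {x y} → ¬ SamePair x y u v → Adj G x y ⇔ R x y)
         (f : H ↪ R) where
  open Graph G using (_≟_; _∈ᵥ_; index)

  -- Here `R` stands for either modification of `G` at the pair `u`, `v`. A copy missing one end
  -- would use only pairs on which `R` and `G` agree, and so would be a copy in `G`.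
  hits-modified-pair : (∃ λ a → fun f a ≡ u) × (∃ λ b → fun f b ≡ v)
  hits-modified-pair =
    hit (λ { u∉ (inj₁ (p , _)) → u∉ (_ , p) ; u∉ (inj₂ (_ , p)) → u∉ (_ , p) }) ,
    hit (λ { v∉ (inj₁ (_ , p)) → v∉ (_ , p) ; v∉ (inj₂ (p , _)) → v∉ (_ , p) })
    where
    hit : ∀ {w} → (¬ (∃ λ a → fun f a ≡ w) → ∀ {x y} → ¬ SamePair (fun f x) (fun f y) u v) →
      ∃ λ a → fun f a ≡ w
    hit {w} avoid = decidable-stable (any-vertex? H λ a → fun f a ≟ w) λ w∉ → H↪̸G record
      { fun       = fun f
      ; injective = injective f
      ; adj       = mk⇔
          (from (agree (avoid w∉)) ∘ to (adj f))
          (from (adj f) ∘ to (agree (avoid w∉)))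
      }

  -- Both ends of the changed pair are in `X`, so no pair with a vertex outside `X` changes and `X`
  -- remains a module for `R`. Its trace on `H` contains the distinct preimages of `u` and `v`,
  -- hence is everything.
  inside-homogeneous : ∀ {X} → Homogeneous G X → u ∈ᵥ X → v ∈ᵥ X → ∀ x → fun f x ∈ᵥ X
  inside-homogeneous {X} X-hom u∈X v∈X =
    let ((a , fa≡u) , (b , fb≡v)) = hits-modified-pair in
    prime-module H prime (λ x → index (fun f x) ∈? X)
      (λ w∉ x∈ y∈ wx → from (adj f) (to (agree (unmodified w∉))
        (homogeneous-adj G X-hom w∉ x∈ y∈ (from (agree (unmodified w∉)) (to (adj f) wx)))))
      (subst (_∈ᵥ X) (sym fa≡u) u∈X) (subst (_∈ᵥ X) (sym fb≡v) v∈X)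
      λ a≡b → u≢v (trans (sym fa≡u) (trans (cong (fun f) a≡b) fb≡v))
    where
    unmodified : ∀ {w x} → ¬ w ∈ᵥ X → ¬ SamePair w x u v
    unmodified w∉ (inj₁ (refl , _)) = w∉ u∈X
    unmodified w∉ (inj₂ (refl , _)) = w∉ v∈X

-- Descent to a prime saturated graph.

homogeneous-saturated : {H : Graph} → Prime H → (G : Graph) → InducedSaturated H G →
  ∀ {X} → Homogeneous G X → InducedSaturated H (induced G X)
homogeneous-saturated {H} prime G sat {X} X-hom = record
  { H-free   = λ H⊆ → H↪̸G (↪-trans (⊆ᴵ⇒↪ (induced G X) H⊆) (induced-↪ G X))
  ; deletion = λ {x} {y} → deletion {x} {y}
  ; addition = addition
  }
  where
  module S = InducedSaturated sat

  H↪̸G : ¬ H ↪ Adj G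
  H↪̸G = S.H-free ∘ ↪⇒⊆ᴵ G

  deletion : ∀ {x y} (e : Adj (induced G X) x y) → H ⊆ᴵ deleteEdge (induced G X) {x} {y} e
  deletion {x@(u , u∈X)} {y@(v , v∈X)} e =
    let f   = ⊆ᴵ⇒↪ (deleteEdge G e) (S.deletion e)
        f∈X = inside-homogeneous prime G H↪̸G (λ { refl → Graph.loopless G e })
                (λ ≢uv → mk⇔ (_, ≢uv) proj₁) f X-hom u∈X v∈X
    -- The copy lies in `X`, so it factors through the inclusion of the modified induced graph into
    -- the modified `G`.
    in ↪⇒⊆ᴵ (deleteEdge (induced G X) {x} {y} e)
         (↪-factor f (deleteEdge-↪ (induced G X) G (induced-↪ G X) e e refl refl)
           (λ x → fun f x , f∈X x) λ _ → refl)

  addition : ∀ {x y} (e : Adj (complement (induced G X)) x y) → H ⊆ᴵ addEdge (induced G X) e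
  addition {u , u∈X} {v , v∈X} e@(x≢y , ¬uv) =
    let u≢v = x≢y ∘ ∈ᵥ-pair-≡ G
        e′  = u≢v , ¬uv
        f   = ⊆ᴵ⇒↪ (addEdge G e′) (S.addition e′)
        f∈X = inside-homogeneous prime G H↪̸G u≢v
                (λ ≢uv → mk⇔ inj₁ Sum.[ id , ⊥-elim ∘ ≢uv ]) f X-hom u∈X v∈X
    in ↪⇒⊆ᴵ (addEdge (induced G X) e)
         (↪-factor f (addEdge-↪ (induced G X) G (induced-↪ G X) e e′ refl refl)
           (λ x → fun f x , f∈X x) λ _ → refl)

prime-saturated : {H : Graph} → Prime H → (G : Graph) → Acc _<_ (order G) →
  InducedSaturated H G → ∃[ G' ] Prime G' × InducedSaturated H G'
prime-saturated prime G (acc rec) sat with anySubset? (homogeneous? G)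
... | no G-prime        = G , G-prime , sat
... | yes (X , X-hom) = prime-saturated prime (induced G X)
  -- The order of `induced G X` is the size of `X`, so properness is exactly the decrease required.
  (rec (Homogeneous.proper X-hom)) (homogeneous-saturated prime G sat X-hom)

theorem20 : (H : Graph) → Prime H →
    (G : Graph) → InducedSaturated H G →
    InducedSaturated H (G ⋆ G) ×
    (∃[ G' ] Prime G' × InducedSaturated H G')
theorem20 H prime G sat =
  ⋆-saturated prime G G sat sat , prime-saturated prime G (<-wellFounded (order G)) sat
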